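{- Let $f:\mathbb{N}\to\mathbb{N}$ be a function with $\max_n f(n)=N$. Let $t=\max(2, t_0)$ where $t_0$ is the largest integer $t'$ with $t'^{\,e t'}\leq N$ (and $t=2$ if no integer $t'\ge 2$ satisfies this). Then there is an absolute constant $C$ (independent of $n$, $f$, $N$) such that for every $n$, every $w\in\{0,1\}^n$ and every $\mathcal{B}\subseteq\{0,1\}^n\setminus\{w\}$ with $|\mathcal{B}|=f(n)$, there is a first-order sentence over $\tau_{\mathsf{string}}$ with at most $\log_2(n)+\log_t(N)+C$ quantifiers true in $\mathbf{B}_w$ and false in $\mathbf{B}_{w'}$ for all $w'\in\mathcal{B}$.
   Context: Here $e$ is Euler's number. Vocabulary $\tau_{\mathsf{string}}=\langle <, S;\ \mathsf{min},\mathsf{max}\rangle$ with $<$ binary, $S$ unary, $\mathsf{min},\mathsf{max}$ constants. A string $w=w_1\cdots w_n\in\{0,1\}^n$ ($n\geq 1$) is encoded by the structure $\mathbf{B}_w$ with universe $\{1,\dots,n\}$, $<$ the usual order, $S=\{i: w_i=1\}$, $\mathsf{min}=1$, $\mathsf{max}=n$. The number of quantifiers is the number of quantifier occurrences. -}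

module Defs where

open import Data.Bool using (Bool; true)
open import Data.Fin as Fin using (Fin; fromℕ)
open import Data.Integer using (+_; ∣_∣)
open import Data.Nat using (ℕ; zero; suc; _+_; _^_; _≤_; _<_; _⊔_; _!; NonZero)
open import Data.Nat.Properties using (_!≢0)
open import Data.Product using (_×_; ∃-syntax)
open import Data.Rational.Unnormalised as ℚ using (ℚᵘ; ↥_; ↧ₙ_; _/_; _≃_)
open import Data.Sum using (_⊎_)
open import Data.Vec as Vec using (Vec)
open import Relation.Binary.PropositionalEquality using (_≡_)
open import Relation.Nullary using (¬_)

-- First-order logic (with equality) over τ_string = ⟨<, S; min, max⟩.
-- Variables are de Bruijn indices; `Formula k` has free variables among
-- k many.

data Term (k : ℕ) : Set where
  var     : Fin k → Term k
  min max : Term k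

infix  7 _≐_ _≺_
infixr 6 _∧′_
infixr 5 _∨′_

data Formula (k : ℕ) : Set where
  _≐_ _≺_   : Term k → Term k → Formula k
  S         : Term k → Formula k
  ¬′_       : Formula k → Formula k
  _∧′_ _∨′_ : Formula k → Formula k → Formula k
  ∃′ ∀′     : Formula (suc k) → Formula k

Sentence : Set
Sentence = Formula 0

quantifiers : ∀ {k} → Formula k → ℕ
quantifiers (s ≐ t)  = 0
quantifiers (s ≺ t)  = 0
quantifiers (S t)    = 0
quantifiers (¬′ φ)   = quantifiers φ
quantifiers (φ ∧′ ψ) = quantifiers φ + quantifiers ψ
quantifiers (φ ∨′ ψ) = quantifiers φ + quantifiers ψ
quantifiers (∃′ φ)   = suc (quantifiers φ)
quantifiers (∀′ φ)   = suc (quantifiers φ)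

record Structure : Set₁ where
  field
    Universe : Set
    Less     : Universe → Universe → Set
    Sᴵ       : Universe → Set
    minᴵ     : Universe
    maxᴵ     : Universe

module _ (𝐀 : Structure) where
  open Structure 𝐀

  ⟦_⟧ : ∀ {k} → Term k → Vec Universe k → Universe
  ⟦ var i ⟧ ρ = Vec.lookup ρ i
  ⟦ min   ⟧ ρ = minᴵ
  ⟦ max   ⟧ ρ = maxᴵ

  Sat : ∀ {k} → Vec Universe k → Formula k → Set
  Sat ρ (s ≐ t)  = ⟦ s ⟧ ρ ≡ ⟦ t ⟧ ρ
  Sat ρ (s ≺ t)  = Less (⟦ s ⟧ ρ) (⟦ t ⟧ ρ)
  Sat ρ (S t)    = Sᴵ (⟦ t ⟧ ρ)
  Sat ρ (¬′ φ)   = ¬ Sat ρ φ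
  Sat ρ (φ ∧′ ψ) = Sat ρ φ × Sat ρ ψ
  Sat ρ (φ ∨′ ψ) = Sat ρ φ ⊎ Sat ρ ψ
  Sat ρ (∃′ φ)   = ∃[ a ] Sat (a Vec.∷ ρ) φ
  Sat ρ (∀′ φ)   = ∀ a → Sat (a Vec.∷ ρ) φ

infix 4 _⊨_

_⊨_ : Structure → Sentence → Set
𝐀 ⊨ φ = Sat 𝐀 Vec.[] φ

-- Position i ∈ {1,…,n} is represented by the element i − 1 of Fin n.
𝐁 : ∀ {n} .{{_ : NonZero n}} → Vec Bool n → Structure
𝐁 {suc m} w = record
  { Universe = Fin (suc m)
  ; Less     = Fin._<_
  ; Sᴵ       = λ i → Vec.lookup w i ≡ true
  ; minᴵ     = Fin.zero
  ; maxᴵ     = fromℕ m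
  }

-- Real numbers enter only as quantities bounding, or bounded by, natural
-- numbers.  A real x is given by an open one-sided Dedekind cut: as an
-- upper real by { r ∈ ℚ : x < r }, as a lower real by { r ∈ ℚ : r < x }.

UpperReal LowerReal : Set₁
UpperReal = ℚᵘ → Set
LowerReal = ℚᵘ → Set

infix  4 _≤ᵁ_
infixl 6 _+ᵁ_
infixl 7 _·ᴸ_

_≤ᵁ_ : UpperReal → UpperReal → Set
x ≤ᵁ y = ∀ r → y r → x r

_+ᵁ_ : UpperReal → UpperReal → UpperReal
(x +ᵁ y) r = ∃[ a ] ∃[ b ] x a × y b × r ≃ a ℚ.+ b

natᵁ : ℕ → UpperReal
natᵁ m r = (+ m / 1) ℚ.< r

-- For b ≥ 2, x ≥ 1 and r = p/d ≥ 0:  log_b x < r  iff  x < b^(p/d)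
-- iff  x^d < b^p.  No negative r lies above log_b x, as log_b x ≥ 0.
-- At x = 0 every r ≥ 0 is in the cut, so that log_b 0 counts as 0 in the
-- bound natᵁ q ≤ᵁ log 2 n +ᵁ log b 0 +ᵁ natᵁ C.
log : ℕ → ℕ → UpperReal
log b x r = ℚ.NonNegative r × x ^ (↧ₙ r) < b ^ ∣ ↥ r ∣

eSum : ℕ → ℚᵘ
eSum zero    = + 1 / 1
eSum (suc k) = eSum k ℚ.+ (+ 1 / (suc k !)) {{suc k !≢0}}

-- Euler's number, e = sup_k Σ_{i ≤ k} 1/i!
e : LowerReal
e r = ∃[ k ] r ℚ.< eSum k

_·ᴸ_ : LowerReal → ℕ → LowerReal
(x ·ᴸ m) r = ∃[ s ] x s × r ≃ s ℚ.* (+ m / 1)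

-- b^x ≤ N for an integer b ≥ 1 and a real x > 0, where
-- b^x = sup { b^(p/d) : 0 ≤ p/d < x }  and  b^(p/d) ≤ N  iff  b^p ≤ N^d.
PowerAtMost : (b : ℕ) (x : LowerReal) (N : ℕ) → Set
PowerAtMost b x N = ∀ r → ℚ.NonNegative r → x r → b ^ ∣ ↥ r ∣ ≤ N ^ (↧ₙ r)

-- t^(e t) ≤ N
Fits : ℕ → ℕ → Set
Fits N t = PowerAtMost t (e ·ᴸ t) N

-- The largest positive integer t₀ with t₀^(e t₀) ≤ N.
IsLargestFitting : ℕ → ℕ → Set
IsLargestFitting N t₀ =
  1 ≤ t₀ × Fits N t₀ × (∀ t′ → 1 ≤ t′ → Fits N t′ → t′ ≤ t₀)

-- A relation rather than a function of N: whether t^(e t) ≤ N holds is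
-- not known to be decidable constructively.
IsBase : ℕ → ℕ → Set
IsBase N t =
    (∃[ t₀ ] IsLargestFitting N t₀ × t ≡ 2 ⊔ t₀)
  ⊎ ((∀ t′ → 2 ≤ t′ → ¬ Fits N t′) × t ≡ 2)

IsMaximum : (ℕ → ℕ) → ℕ → Set
IsMaximum f N = (∀ n → f n ≤ N) × (∃[ n ] f n ≡ N)

{-# OPTIONS --safe #-}

-- Let m = ⌈log_t N⌉.  If t ≥ 3 then e t ≤ log_t N ≤ m, so that
-- m! ≥ (m / e)^m ≥ t^m ≥ N; if t = 2 then (m + 1)! ≥ 2^m ≥ N.  With m + 1
-- universal quantifiers one speaks about a tuple of positions, and its order
-- type takes (m + 1)! values, so that every w′ ∈ ℬ can be given an order type
-- of its own.  The sentence says that a tuple of the type of w′ is accompanied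
-- by the letter of w at a fixed position where w and w′ differ.  Positions are
-- named by bisection with a prefix ∃¬∃¬… of length ⌈log₂ n⌉ + 3, the same
-- for all positions; hence these claims are merged under one prefix by a
-- quantifier-free case distinction on the order type.  If n ≤ m, there is no
-- room for all order types, but n quantifiers suffice to spell out w.

module Submission where

open import Defs
open import Data.Bool using (Bool; true; false)
open import Data.Bool.Properties using () renaming (_≟_ to _≟ᵇ_)
open import Data.Fin as Fin
  using (Fin; zero; suc; toℕ; fromℕ; fromℕ<; inject≤; punchIn; punchOut; remQuot; combine)
open import Data.Fin.Properties as Fin
  using (toℕ<n; toℕ-fromℕ; toℕ-fromℕ<; toℕ-inject≤; toℕ-injective; punchIn-mono-≤;
         punchIn-cancel-≤; punchIn-punchOut; combine-remQuot; _<?_; ¬∀⟶∃¬)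
import Data.Integer as ℤ
import Data.Integer.Properties as ℤ
open import Data.List as List using (List; length)
open import Data.List.Membership.Propositional using (_∈_; _∉_)
open import Data.List.Membership.Propositional.Properties using (∈-lookup)
open import Data.List.Relation.Unary.Any using (index)
open import Data.List.Relation.Unary.Any.Properties using (lookup-index)
open import Data.List.Relation.Unary.Unique.Propositional using (Unique)
open import Data.Nat hiding (_<?_)
open import Data.Nat.Properties hiding (_<?_)
open import Data.Nat.Tactic.RingSolver using (solve-∀)
open import Data.Product using (_×_; _,_; ∃-syntax; proj₁; proj₂; map₂)
open import Data.Rational.Unnormalised as ℚ using (ℚᵘ; mkℚᵘ; _≃_; *≡*; *<*; *≤*)
import Data.Rational.Unnormalised.Properties as ℚ
open import Data.Sum using (_⊎_; inj₁; inj₂; [_,_])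
open import Data.Vec using (Vec; []; _∷_; lookup; tabulate)
open import Data.Vec.Properties using (lookup∘tabulate; tabulate∘lookup; tabulate-cong)
open import Function using (id; _∘_; _⇔_; mk⇔; Equivalence)
open import Function.Properties.Equivalence using () renaming (sym to ⇔-sym; trans to ⇔-trans)
open import Relation.Binary using (tri<; tri≈; tri>)
open import Relation.Binary.PropositionalEquality
  using (_≡_; _≢_; refl; sym; trans; cong; cong₂; subst; subst₂)
open import Relation.Nullary using (¬_; Dec; yes; no; ¬?; _×-dec_; _⊎-dec_; contradiction)
open Equivalence using (to; from)
open ≤-Reasoning

-- Quantifier-free formulas and alternating prefixes

data Matrix (k : ℕ) : Set where
  ⊤ᵐ          : Matrix k
  _<ᵐ_        : Term k → Term k → Matrix k
  Sᵐ          : Term k → Matrix k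
  ¬ᵐ_         : Matrix k → Matrix k
  _∧ᵐ_ _∨ᵐ_   : Matrix k → Matrix k → Matrix k

infix  8 ¬ᵐ_
infix  7 _<ᵐ_
infixr 6 _∧ᵐ_
infixr 5 _∨ᵐ_

⌜_⌝ : ∀ {k} → Matrix k → Formula k
⌜ ⊤ᵐ ⌝     = min ≐ min
⌜ s <ᵐ t ⌝ = s ≺ t
⌜ Sᵐ t ⌝   = S t
⌜ ¬ᵐ p ⌝   = ¬′ ⌜ p ⌝
⌜ p ∧ᵐ q ⌝ = ⌜ p ⌝ ∧′ ⌜ q ⌝
⌜ p ∨ᵐ q ⌝ = ⌜ p ⌝ ∨′ ⌜ q ⌝

quantifiers-⌜⌝ : ∀ {k} (p : Matrix k) → quantifiers ⌜ p ⌝ ≡ 0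
quantifiers-⌜⌝ ⊤ᵐ       = refl
quantifiers-⌜⌝ (s <ᵐ t) = refl
quantifiers-⌜⌝ (Sᵐ t)   = refl
quantifiers-⌜⌝ (¬ᵐ p)   = quantifiers-⌜⌝ p
quantifiers-⌜⌝ (p ∧ᵐ q) = cong₂ _+_ (quantifiers-⌜⌝ p) (quantifiers-⌜⌝ q)
quantifiers-⌜⌝ (p ∨ᵐ q) = cong₂ _+_ (quantifiers-⌜⌝ p) (quantifiers-⌜⌝ q)

wkᵗ : ∀ {k} → Term k → Term (suc k)
wkᵗ (var i) = var (suc i)
wkᵗ min     = min
wkᵗ max     = max

wk : ∀ {k} → Matrix k → Matrix (suc k)
wk ⊤ᵐ       = ⊤ᵐ
wk (s <ᵐ t) = wkᵗ s <ᵐ wkᵗ t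
wk (Sᵐ t)   = Sᵐ (wkᵗ t)
wk (¬ᵐ p)   = ¬ᵐ wk p
wk (p ∧ᵐ q) = wk p ∧ᵐ wk q
wk (p ∨ᵐ q) = wk p ∨ᵐ wk q

-- `∃¬∃¬…` is an alternating prefix up to negations. Giving all levels the same form lets formulas
-- and their negated counterparts, such as "greater" and "at most", be merged level by level.
data Alternating : ℕ → ℕ → Set where
  matrix : ∀ {k} → Matrix k → Alternating 0 k
  ∃¬_    : ∀ {l k} → Alternating l (suc k) → Alternating (suc l) k

⌊_⌋ : ∀ {l k} → Alternating l k → Formula k
⌊ matrix p ⌋ = ⌜ p ⌝
⌊ ∃¬ A ⌋     = ∃′ (¬′ ⌊ A ⌋)

quantifiers-⌊⌋ : ∀ {l k} (A : Alternating l k) → quantifiers ⌊ A ⌋ ≡ l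
quantifiers-⌊⌋ (matrix p) = quantifiers-⌜⌝ p
quantifiers-⌊⌋ (∃¬ A)     = cong suc (quantifiers-⌊⌋ A)

-- All formulas of one length l share the prefix ∃¬∃¬…, so that a case
-- distinction on a quantifier-free condition costs no quantifier.
if_then_else_ : ∀ {l k} → Matrix k → Alternating l k → Alternating l k → Alternating l k
if c then matrix p else matrix q = matrix (c ∧ᵐ p ∨ᵐ ¬ᵐ c ∧ᵐ q)
if c then ∃¬ A     else ∃¬ B     = ∃¬ (if wk c then A else B)

-- Padded to the full prefix length, so as to serve as a branch of a case distinction.
verum falsum : ∀ {k} l → Alternating l k
verum  zero    = matrix ⊤ᵐ
verum  (suc l) = ∃¬ falsum l
falsum zero    = matrix (¬ᵐ ⊤ᵐ)
falsum (suc l) = ∃¬ verum l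

infixr 4 _⇒_

_⇒_ : ∀ {l k} → Matrix k → Alternating l k → Alternating l k
_⇒_ {l} c A = if c then A else verum l

v₀ : ∀ {k} → Term (suc k)
v₀ = var zero

v₁ : ∀ {k} → Term (suc (suc k))
v₁ = var (suc zero)

-- A ∨ B when the outermost witness of A can be found below v₀ and that of
-- B at or above v₀.
_or_ : ∀ {l k} → Alternating l (suc k) → Alternating l (suc k) → Alternating l (suc k)
matrix p or matrix q = matrix (p ∨ᵐ q)
(∃¬ A)   or (∃¬ B)   = ∃¬ (if v₀ <ᵐ v₁ then A else B)

-- Under the negation the implication becomes a conjunction: the witness lies in the range, and both
-- `A` and `B` fail there.
∃∈_nor : ∀ {l k} → Matrix (suc k) → Alternating l (suc k) → Alternating l (suc k) →
         Alternating (suc l) k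
∃∈_nor range A B = ∃¬ (range ⇒ (A or B))

-- Distance formulas by bisection

module _ {k} (s t : Term k) where
  -- Only the order test, which tells distance 0 from distance at least 1. In `split` a bound i ≥ 1
  -- is completed by the failure of 1 ≤ z - s ≤ i - 1, and likewise for t - z.
  lower upper : ℕ → Matrix (suc k)
  lower zero    = ¬ᵐ (v₀ <ᵐ wkᵗ s)
  lower (suc _) = wkᵗ s <ᵐ v₀
  upper zero    = ¬ᵐ (wkᵗ t <ᵐ v₀)
  upper (suc _) = v₀ <ᵐ wkᵗ t

-- For l large enough: GT l p s t says p < t − s, LE l q s t says
-- 1 ≤ t − s ≤ q, and split l i j c s t says that some z with i ≤ z − s and
-- j ≤ t − z satisfies c.
GT LE : ∀ {k} (l p : ℕ) (s t : Term k) → Alternating l k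
split : ∀ {k} (l i j : ℕ) (c : Matrix (suc k)) (s t : Term k) → Alternating (suc l) k

GT zero    p s t = matrix (s <ᵐ t)
GT (suc l) p s t = split l ⌈ p /2⌉ (suc ⌊ p /2⌋) ⊤ᵐ s t

LE zero    q s t = falsum 0
-- The witness u satisfies s ≤ u < t, u - s ≤ ⌊q/2⌋ and t - u ≤ ⌈q/2⌉. The strict inequality u < t
-- rules out t = s.
LE (suc l) q s t =
  ∃∈ lower s t 0 ∧ᵐ upper s t 1 nor
    (GT l ⌊ q /2⌋ (wkᵗ s) v₀) (GT l ⌈ q /2⌉ v₀ (wkᵗ t))

split l i j c s t =
  ∃∈ (lower s t i ∧ᵐ upper s t j) ∧ᵐ c nor
    (LE l (pred i) (wkᵗ s) v₀) (LE l (pred j) v₀ (wkᵗ t))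

-- Arithmetic of halving

no-gap : ∀ {x y} i → x + i ≤ y → x < y → ¬ (y ≤ x + pred i)
no-gap {x} {y} zero    x+i≤y x<y y≤ = <⇒≱ x<y (subst (y ≤_) (+-identityʳ x) y≤)
no-gap {x} {y} (suc i) x+i≤y x<y y≤ = <⇒≱ (subst (_≤ y) (+-suc x i) x+i≤y) y≤

⌈n/2⌉+suc⌊n/2⌋≡suc[n] : ∀ n → ⌈ n /2⌉ + suc ⌊ n /2⌋ ≡ suc n
⌈n/2⌉+suc⌊n/2⌋≡suc[n] n = trans (+-suc _ _) (cong suc (trans (+-comm ⌈ n /2⌉ _) (⌊n/2⌋+⌈n/2⌉≡n n)))

pred⌈n/2⌉≤⌊n/2⌋ : ∀ n → pred ⌈ n /2⌉ ≤ ⌊ n /2⌋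
pred⌈n/2⌉≤⌊n/2⌋ zero    = z≤n
pred⌈n/2⌉≤⌊n/2⌋ (suc n) = ⌊n/2⌋-mono (n≤1+n n)

2*⌊n/2⌋≤n : ∀ n → 2 * ⌊ n /2⌋ ≤ n
2*⌊n/2⌋≤n zero          = z≤n
2*⌊n/2⌋≤n (suc zero)    = z≤n
2*⌊n/2⌋≤n (suc (suc n)) = subst (_≤ 2+ n) (sym (*-suc 2 ⌊ n /2⌋)) (s≤s (s≤s (2*⌊n/2⌋≤n n)))

2*m≤1+2*n⇒m≤n : ∀ m n → 2 * m ≤ 1 + 2 * n → m ≤ n
2*m≤1+2*n⇒m≤n m n le = s≤s⁻¹ (*-cancelˡ-< 2 m (suc n) (subst (2 * m <_) (sym (*-suc 2 n)) (s≤s le)))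

halve-GT : ∀ l p → 4 * p ≤ 2 + 2 ^ suc l → 4 * ⌊ p /2⌋ ≤ 1 + 2 ^ l
halve-GT l p le = *-cancelˡ-≤ 2 (begin
  2 * (4 * ⌊ p /2⌋)   ≡⟨ *-assoc 2 4 ⌊ p /2⌋ ⟨
  8 * ⌊ p /2⌋         ≡⟨ *-assoc 4 2 ⌊ p /2⌋ ⟩
  4 * (2 * ⌊ p /2⌋)   ≤⟨ *-monoʳ-≤ 4 (2*⌊n/2⌋≤n p) ⟩
  4 * p               ≤⟨ le ⟩
  2 + 2 * 2 ^ l       ≡⟨ *-suc 2 (2 ^ l) ⟨
  2 * (1 + 2 ^ l)     ∎)

-- By parity the hypothesis improves to 2q ≤ 2^l, and rounding q/2 up costs at most 1/2; hence the
-- summand 2.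
halve-LE : ∀ l q → 4 * q ≤ 1 + 2 ^ suc l → 4 * ⌈ q /2⌉ ≤ 2 + 2 ^ l
halve-LE l q le = begin
  4 * ⌈ q /2⌉         ≡⟨ *-assoc 2 2 ⌈ q /2⌉ ⟩
  2 * (2 * ⌈ q /2⌉)   ≤⟨ *-monoʳ-≤ 2 (2*⌊n/2⌋≤n (suc q)) ⟩
  2 * suc q           ≡⟨ *-suc 2 q ⟩
  2 + 2 * q           ≤⟨ +-monoʳ-≤ 2 (2*m≤1+2*n⇒m≤n (2 * q) (2 ^ l) (subst (_≤ 1 + 2 * 2 ^ l) (*-assoc 2 2 q) le)) ⟩
  2 + 2 ^ l           ∎

o<m⇒m∸[1+n]<m : ∀ {o m} n → o < m → m ∸ suc n < m
o<m⇒m∸[1+n]<m {m = suc m} n _ = s≤s (m∸n≤m m n)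

below : ∀ {n} (b : Fin n) k → k ≤ toℕ b → ∃[ z ] toℕ {n} z ≡ k
below b k k≤b = fromℕ< (≤-<-trans k≤b (toℕ<n b)) , toℕ-fromℕ< _

-- Semantics of case distinctions and distance formulas

module Semantics {m} (w : Vec Bool (suc m)) where

  U : Set
  U = Fin (suc m)

  infix 3 _⊩_ _⊩ᵃ_

  _⊩_ : ∀ {k} → Vec U k → Matrix k → Set
  ρ ⊩ p = Sat (𝐁 w) ρ ⌜ p ⌝

  _⊩ᵃ_ : ∀ {l k} → Vec U k → Alternating l k → Set
  ρ ⊩ᵃ A = Sat (𝐁 w) ρ ⌊ A ⌋

  value : ∀ {k} → Vec U k → Term k → ℕ
  value ρ t = toℕ (⟦ 𝐁 w ⟧ t ρ)

  ⊩? : ∀ {k} (ρ : Vec U k) (p : Matrix k) → Dec (ρ ⊩ p)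
  ⊩? ρ ⊤ᵐ       = yes refl
  ⊩? ρ (s <ᵐ t) = ⟦ 𝐁 w ⟧ s ρ <? ⟦ 𝐁 w ⟧ t ρ
  ⊩? ρ (Sᵐ t)   = lookup w (⟦ 𝐁 w ⟧ t ρ) ≟ᵇ true
  ⊩? ρ (¬ᵐ p)   = ¬? (⊩? ρ p)
  ⊩? ρ (p ∧ᵐ q) = ⊩? ρ p ×-dec ⊩? ρ q
  ⊩? ρ (p ∨ᵐ q) = ⊩? ρ p ⊎-dec ⊩? ρ q

  ⟦wkᵗ⟧ : ∀ {k x} {ρ : Vec U k} (t : Term k) → ⟦ 𝐁 w ⟧ (wkᵗ t) (x ∷ ρ) ≡ ⟦ 𝐁 w ⟧ t ρ
  ⟦wkᵗ⟧ (var i) = refl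
  ⟦wkᵗ⟧ min     = refl
  ⟦wkᵗ⟧ max     = refl

  value-wkᵗ : ∀ {k x} {ρ : Vec U k} (t : Term k) → value (x ∷ ρ) (wkᵗ t) ≡ value ρ t
  value-wkᵗ t = cong toℕ (⟦wkᵗ⟧ t)

  ⊩-wk : ∀ {k x} {ρ : Vec U k} (p : Matrix k) → (x ∷ ρ ⊩ wk p) ≡ (ρ ⊩ p)
  ⊩-wk ⊤ᵐ       = refl
  ⊩-wk (s <ᵐ t) = cong₂ Fin._<_ (⟦wkᵗ⟧ s) (⟦wkᵗ⟧ t)
  ⊩-wk (Sᵐ t)   = cong (λ i → lookup w i ≡ true) (⟦wkᵗ⟧ t)
  ⊩-wk (¬ᵐ p)   = cong ¬_ (⊩-wk p)
  ⊩-wk (p ∧ᵐ q) = cong₂ _×_ (⊩-wk p) (⊩-wk q)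
  ⊩-wk (p ∨ᵐ q) = cong₂ _⊎_ (⊩-wk p) (⊩-wk q)

  if-true : ∀ {l k} {ρ : Vec U k} c (A B : Alternating l k) → ρ ⊩ c →
            (ρ ⊩ᵃ if c then A else B) ⇔ (ρ ⊩ᵃ A)
  if-true c (matrix p) (matrix q) yc = mk⇔ [ proj₂ , (λ (nc , _) → contradiction yc nc) ]
                                           (λ yp → inj₁ (yc , yp))
  if-true {ρ = ρ} c (∃¬ A) (∃¬ B) yc = mk⇔ (map₂ (λ {x} → _∘ from (rec x))) (map₂ (λ {x} → _∘ to (rec x)))
    where rec = λ x → if-true {ρ = x ∷ ρ} (wk c) A B (subst (λ X → X) (sym (⊩-wk c)) yc)

  if-false : ∀ {l k} {ρ : Vec U k} c (A B : Alternating l k) → ¬ (ρ ⊩ c) →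
             (ρ ⊩ᵃ if c then A else B) ⇔ (ρ ⊩ᵃ B)
  if-false c (matrix p) (matrix q) nc = mk⇔ [ (λ (yc , _) → contradiction yc nc) , proj₂ ]
                                            (λ yq → inj₂ (nc , yq))
  if-false {ρ = ρ} c (∃¬ A) (∃¬ B) nc = mk⇔ (map₂ (λ {x} → _∘ from (rec x))) (map₂ (λ {x} → _∘ to (rec x)))
    where rec = λ x → if-false {ρ = x ∷ ρ} (wk c) A B (nc ∘ subst (λ X → X) (⊩-wk c))

  ⊩-verum  : ∀ {k} {ρ : Vec U k} l → ρ ⊩ᵃ verum l
  ⊮-falsum : ∀ {k} {ρ : Vec U k} l → ¬ (ρ ⊩ᵃ falsum l)
  ⊩-verum  zero    = refl
  ⊩-verum  (suc l) = zero , ⊮-falsum l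
  ⊮-falsum zero    ¬⊤      = ¬⊤ refl
  ⊮-falsum (suc l) (_ , ¬⊤) = ¬⊤ (⊩-verum l)

  ⊮-⇒ : ∀ {l k} {ρ : Vec U k} c (A : Alternating l k) →
        ¬ (ρ ⊩ᵃ c ⇒ A) → (ρ ⊩ c) × ¬ (ρ ⊩ᵃ A)
  ⊮-⇒ {l} {ρ = ρ} c A n with ⊩? ρ c
  ... | yes yc = yc , n ∘ from (if-true c A (verum l) yc)
  ... | no  nc = contradiction (from (if-false c A (verum l) nc) (⊩-verum l)) n

  infix 3 _⊩_by_

  -- Satisfaction with control over where the outermost witness lies, which is what `or` needs in
  -- order to choose the right branch. A matrix has no witness to control.
  _⊩_by_ : ∀ {l k} → Vec U k → Alternating l k → (U → Set) → Set
  ρ ⊩ matrix p by P = ρ ⊩ p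
  ρ ⊩ ∃¬ A     by P = ∃[ x ] P x × ¬ (x ∷ ρ ⊩ᵃ A)

  forget : ∀ {l k P} {ρ : Vec U k} (A : Alternating l k) → ρ ⊩ A by P → ρ ⊩ᵃ A
  forget (matrix p) y           = y
  forget (∃¬ A)     (x , _ , n) = x , n

  module _ {k} {z : U} {ρ : Vec U k} where

    or-introˡ : ∀ {l} (A B : Alternating l (suc k)) →
                z ∷ ρ ⊩ A by (Fin._< z) → z ∷ ρ ⊩ᵃ A or B
    or-introˡ (matrix p) (matrix q) y             = inj₁ y
    or-introˡ (∃¬ A)     (∃¬ B)     (x , x<z , n) = x , n ∘ to (if-true (v₀ <ᵐ v₁) A B x<z)

    or-introʳ : ∀ {l} (A B : Alternating l (suc k)) →
                z ∷ ρ ⊩ B by (z Fin.≤_) → z ∷ ρ ⊩ᵃ A or B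
    or-introʳ (matrix p) (matrix q) y             = inj₂ y
    or-introʳ (∃¬ A)     (∃¬ B)     (x , z≤x , n) = x , n ∘ to (if-false (v₀ <ᵐ v₁) A B (≤⇒≯ z≤x))

    -- The position of the witness selects a branch, and that branch holds as it stands, so no
    -- control over witnesses is needed in this direction.
    or-elim : ∀ {l} (A B : Alternating l (suc k)) → z ∷ ρ ⊩ᵃ A or B →
              (z ∷ ρ ⊩ᵃ A) ⊎ (z ∷ ρ ⊩ᵃ B)
    or-elim (matrix p) (matrix q) y = y
    or-elim (∃¬ A) (∃¬ B) (x , n) with x <? z
    ... | yes x<z = inj₁ (x , n ∘ from (if-true (v₀ <ᵐ v₁) A B x<z))
    ... | no  x≮z = inj₂ (x , n ∘ from (if-false (v₀ <ᵐ v₁) A B x≮z))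

  ∃∈nor-intro : ∀ {l k P z} {ρ : Vec U k} range (A B : Alternating l (suc k)) →
                P z → z ∷ ρ ⊩ range → ¬ (z ∷ ρ ⊩ᵃ A) → ¬ (z ∷ ρ ⊩ᵃ B) →
                ρ ⊩ (∃∈ range nor A B) by P
  ∃∈nor-intro {l} range A B Pz r ¬A ¬B =
    _ , Pz , [ ¬A , ¬B ] ∘ or-elim A B ∘ to (if-true range (A or B) (verum l) r)

  module _ {k} (s t : Term k) {ρ : Vec U k} {z : U} where

    lower-intro : ∀ i → value ρ s + i ≤ toℕ z → z ∷ ρ ⊩ lower s t i
    lower-intro zero    s≤z rewrite ⟦wkᵗ⟧ {x = z} {ρ} s = ≤⇒≯ (≤-trans (m≤m+n _ 0) s≤z)
    lower-intro (suc i) s<z rewrite ⟦wkᵗ⟧ {x = z} {ρ} s = ≤-trans (m<m+n _ z<s) s<z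

    upper-intro : ∀ j → toℕ z + j ≤ value ρ t → z ∷ ρ ⊩ upper s t j
    upper-intro zero    z≤t rewrite ⟦wkᵗ⟧ {x = z} {ρ} t = ≤⇒≯ (≤-trans (m≤m+n _ 0) z≤t)
    upper-intro (suc j) z<t rewrite ⟦wkᵗ⟧ {x = z} {ρ} t = ≤-trans (m<m+n _ z<s) z<t

  -- These directions hold for every `l`: too short a prefix only makes `GT` weaker and `LE`
  -- stronger. They are proved together because each formula negates the other one at the next
  -- level. The hypothesis on `P` keeps the outermost witness in the interval [s, t).
  GT-complete : ∀ {k} l p (s t : Term k) {ρ : Vec U k} {P : U → Set} →
                (∀ {x} → value ρ s ≤ toℕ x → toℕ x < value ρ t → P x) →
                value ρ s + p < value ρ t → ρ ⊩ GT l p s t by P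
  LE-sound    : ∀ {k} l q (s t : Term k) {ρ : Vec U k} → ρ ⊩ᵃ LE l q s t →
                value ρ s < value ρ t × value ρ t ≤ value ρ s + q
  split-complete : ∀ {k} l i j c (s t : Term k) {ρ : Vec U k} {P : U → Set} {z : U} → P z →
                value ρ s + i ≤ toℕ z → toℕ z + j ≤ value ρ t → z ∷ ρ ⊩ c →
                ρ ⊩ split l i j c s t by P

  split-complete l i j c s t {ρ} {z = z} Pz si≤z zj≤t cz =
    ∃∈nor-intro ((lower s t i ∧ᵐ upper s t j) ∧ᵐ c)
                (LE l (pred i) (wkᵗ s) v₀) (LE l (pred j) v₀ (wkᵗ t)) Pz
      ((lower-intro s t i si≤z , upper-intro s t j zj≤t) , cz)
      (λ y → let s<z , z≤ = LE-sound l (pred i) (wkᵗ s) v₀ y in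
             no-gap i si≤z (subst (_< _) ws s<z) (subst (λ a → _ ≤ a + _) ws z≤))
      (λ y → let z<t , t≤ = LE-sound l (pred j) v₀ (wkᵗ t) y in
             no-gap j zj≤t (subst (_ <_) wt z<t) (subst (_≤ _) wt t≤))
    where
    ws = value-wkᵗ s
    wt = value-wkᵗ t

  GT-complete zero    p s t all s+p<t = m+n≤o⇒m≤o _ s+p<t
  GT-complete (suc l) p s t {ρ} all s+p<t
    -- z is placed at distance exactly ⌈p/2⌉ from s; what remains up to t is then at least ⌊p/2⌋ +
    -- 1.
    with below (⟦ 𝐁 w ⟧ t ρ) (value ρ s + ⌈ p /2⌉)
           (≤-trans (+-monoʳ-≤ (value ρ s) (⌈n/2⌉≤n p)) (<⇒≤ s+p<t))
  ... | z , z≡ = split-complete l ⌈ p /2⌉ (suc ⌊ p /2⌋) ⊤ᵐ s t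
        (all (≤-trans (m≤m+n _ _) (≤-reflexive (sym z≡))) (≤-trans (m<m+n _ z<s) z+j≤t))
        (≤-reflexive (sym z≡)) z+j≤t refl
    where
    z+j≤t : toℕ z + suc ⌊ p /2⌋ ≤ value ρ t
    z+j≤t = begin
      toℕ z + suc ⌊ p /2⌋                    ≡⟨ cong (_+ suc ⌊ p /2⌋) z≡ ⟩
      value ρ s + ⌈ p /2⌉ + suc ⌊ p /2⌋      ≡⟨ +-assoc (value ρ s) _ _ ⟩
      value ρ s + (⌈ p /2⌉ + suc ⌊ p /2⌋)    ≡⟨ cong (value ρ s +_) (⌈n/2⌉+suc⌊n/2⌋≡suc[n] p) ⟩
      value ρ s + suc p                      ≡⟨ +-suc _ p ⟩
      suc (value ρ s + p)                    ≤⟨ s+p<t ⟩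
      value ρ t                              ∎

  LE-sound zero    q s t ¬⊤ = contradiction refl ¬⊤
  LE-sound (suc l) q s t {ρ} (u , n)
    with ⊮-⇒ (lower s t 0 ∧ᵐ upper s t 1) (GT l ⌊ q /2⌋ (wkᵗ s) v₀ or GT l ⌈ q /2⌉ v₀ (wkᵗ t)) n
  ... | (u≮s , u<t) , ¬or = s<t , t≤s+q
    where
    s≤u : value ρ s ≤ toℕ u
    s≤u = ≮⇒≥ (subst (λ a → ¬ toℕ u < a) (value-wkᵗ s) u≮s)
    u<t′ : toℕ u < value ρ t
    u<t′ = subst (toℕ u <_) (value-wkᵗ t) u<t
    s<t : value ρ s < value ρ t
    s<t = ≤-<-trans s≤u u<t′
    u≤ : toℕ u ≤ value ρ s + ⌊ q /2⌋
    -- Were u farther from s, the first half of the disjunction would hold with a witness below u,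
    -- which is the side that `or` assigns to it.
    u≤ = ≮⇒≥ λ lt → ¬or (or-introˡ (GT l ⌊ q /2⌋ (wkᵗ s) v₀) (GT l ⌈ q /2⌉ v₀ (wkᵗ t))
           (GT-complete l _ (wkᵗ s) v₀ (λ _ x<u → x<u)
             (subst (λ a → a + ⌊ q /2⌋ < toℕ u) (sym (value-wkᵗ s)) lt)))
    t≤ : value ρ t ≤ toℕ u + ⌈ q /2⌉
    t≤ = ≮⇒≥ λ lt → ¬or (or-introʳ (GT l ⌊ q /2⌋ (wkᵗ s) v₀) (GT l ⌈ q /2⌉ v₀ (wkᵗ t))
           (GT-complete l _ v₀ (wkᵗ t) (λ u≤x _ → u≤x)
             (subst (toℕ u + ⌈ q /2⌉ <_) (sym (value-wkᵗ t)) lt)))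
    t≤s+q : value ρ t ≤ value ρ s + q
    t≤s+q = begin
      value ρ t                          ≤⟨ t≤ ⟩
      toℕ u + ⌈ q /2⌉                    ≤⟨ +-monoˡ-≤ ⌈ q /2⌉ u≤ ⟩
      value ρ s + ⌊ q /2⌋ + ⌈ q /2⌉      ≡⟨ +-assoc (value ρ s) _ _ ⟩
      value ρ s + (⌊ q /2⌋ + ⌈ q /2⌉)    ≡⟨ cong (value ρ s +_) (⌊n/2⌋+⌈n/2⌉≡n q) ⟩
      value ρ s + q                      ∎

  -- The converse directions need a long enough prefix. At `l` = 0 the size bounds force p = 0 and q
  -- = 0, where the base formulas are exact; the constants 2 and 1 absorb the rounding at each
  -- halving.
  GT-sound    : ∀ {k} l p (s t : Term k) {ρ : Vec U k} → 4 * p ≤ 2 + 2 ^ l →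
                ρ ⊩ᵃ GT l p s t → value ρ s + p < value ρ t
  LE-complete : ∀ {k} l q (s t : Term k) {ρ : Vec U k} {P : U → Set} →
                (∀ {x} → value ρ s ≤ toℕ x → toℕ x < value ρ t → P x) → 4 * q ≤ 1 + 2 ^ l →
                value ρ s < value ρ t → value ρ t ≤ value ρ s + q → ρ ⊩ LE l q s t by P
  split-sound : ∀ {k} l i j c (s t : Term k) {ρ : Vec U k} →
                4 * pred i ≤ 1 + 2 ^ l → 4 * pred j ≤ 1 + 2 ^ l → ρ ⊩ᵃ split l i j c s t →
                ∃[ z ] value ρ s + i ≤ toℕ z × toℕ z + j ≤ value ρ t × (z ∷ ρ ⊩ c)

  split-sound l i j c s t {ρ} i-small j-small (z , n)
    with ⊮-⇒ ((lower s t i ∧ᵐ upper s t j) ∧ᵐ c) (LE l (pred i) (wkᵗ s) v₀ or LE l (pred j) v₀ (wkᵗ t)) n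
  ... | ((yl , yu) , yc) , ¬or = z , si≤z i ¬A yl , zj≤t j ¬B yu , yc
    where
    ¬A : value ρ s < toℕ z → ¬ (toℕ z ≤ value ρ s + pred i)
    ¬A s<z z≤ = ¬or (or-introˡ (LE l (pred i) (wkᵗ s) v₀) (LE l (pred j) v₀ (wkᵗ t))
      (LE-complete l (pred i) (wkᵗ s) v₀ (λ _ x<z → x<z) i-small
        (subst (_< toℕ z) (sym (value-wkᵗ s)) s<z)
        (subst (λ a → toℕ z ≤ a + pred i) (sym (value-wkᵗ s)) z≤)))
    ¬B : toℕ z < value ρ t → ¬ (value ρ t ≤ toℕ z + pred j)
    ¬B z<t t≤ = ¬or (or-introʳ (LE l (pred i) (wkᵗ s) v₀) (LE l (pred j) v₀ (wkᵗ t))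
      (LE-complete l (pred j) v₀ (wkᵗ t) (λ z≤x _ → z≤x) j-small
        (subst (toℕ z <_) (sym (value-wkᵗ t)) z<t)
        (subst (_≤ toℕ z + pred j) (sym (value-wkᵗ t)) t≤)))
    si≤z : ∀ i → (value ρ s < toℕ z → ¬ (toℕ z ≤ value ρ s + pred i)) →
           z ∷ ρ ⊩ lower s t i → value ρ s + i ≤ toℕ z
    si≤z zero    _  z≮s = subst (_≤ toℕ z) (sym (+-identityʳ _))
                            (≮⇒≥ (subst (λ a → ¬ toℕ z < a) (value-wkᵗ s) z≮s))
    si≤z (suc i) ¬A s<z = subst (_≤ toℕ z) (sym (+-suc _ i))
                            (≰⇒> (¬A (subst (_< toℕ z) (value-wkᵗ s) s<z)))
    zj≤t : ∀ j → (toℕ z < value ρ t → ¬ (value ρ t ≤ toℕ z + pred j)) →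
           z ∷ ρ ⊩ upper s t j → toℕ z + j ≤ value ρ t
    zj≤t zero    _  t≮z = subst (_≤ value ρ t) (sym (+-identityʳ _))
                            (≮⇒≥ (subst (λ a → ¬ a < toℕ z) (value-wkᵗ t) t≮z))
    zj≤t (suc j) ¬B z<t = subst (_≤ value ρ t) (sym (+-suc _ j))
                            (≰⇒> (¬B (subst (toℕ z <_) (value-wkᵗ t) z<t)))

  GT-sound zero    zero    s t _ s<t = subst (_< _) (sym (+-identityʳ _)) s<t
  GT-sound zero    (suc p) s t small _ = contradiction small (<⇒≱ (*-monoʳ-≤ 4 (s≤s (z≤n {p}))))
  GT-sound (suc l) p s t {ρ} small y with split-sound l ⌈ p /2⌉ (suc ⌊ p /2⌋) ⊤ᵐ s t
        (≤-trans (*-monoʳ-≤ 4 (pred⌈n/2⌉≤⌊n/2⌋ p)) (halve-GT l p small)) (halve-GT l p small) y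
  ... | z , s+i≤z , z+j≤t , _ = begin
      suc (value ρ s + p)                  ≡⟨ +-suc _ p ⟨
      value ρ s + suc p                    ≡⟨ cong (value ρ s +_) (⌈n/2⌉+suc⌊n/2⌋≡suc[n] p) ⟨
      value ρ s + (⌈ p /2⌉ + suc ⌊ p /2⌋)  ≡⟨ +-assoc (value ρ s) _ _ ⟨
      value ρ s + ⌈ p /2⌉ + suc ⌊ p /2⌋    ≤⟨ +-monoˡ-≤ _ s+i≤z ⟩
      toℕ z + suc ⌊ p /2⌋                  ≤⟨ z+j≤t ⟩
      value ρ t                            ∎

  LE-complete l       zero s t all small s<t t≤s+q = contradiction (subst (_ ≤_) (+-identityʳ _) t≤s+q) (<⇒≱ s<t)
  LE-complete zero    (suc q) s t all small s<t t≤s+q =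
    contradiction small (<⇒≱ (≤-trans (s≤s (s≤s (s≤s z≤n))) (*-monoʳ-≤ 4 (s≤s (z≤n {q})))))
  -- u lies as far left as t - u ≤ ⌈q/2⌉ permits, but not below s. Since q ≥ 1, ⌈q/2⌉ is positive
  -- and u < t; since t ≤ s + q, u is within ⌊q/2⌋ of s.
  LE-complete (suc l) q@(suc q′) s t {ρ} all small s<t t≤s+q
    with below (⟦ 𝐁 w ⟧ t ρ) (value ρ s ⊔ (value ρ t ∸ ⌈ q /2⌉)) (⊔-lub (<⇒≤ s<t) (m∸n≤m (value ρ t) ⌈ q /2⌉))
  ... | u , u≡ = ∃∈nor-intro (lower s t 0 ∧ᵐ upper s t 1) (GT l ⌊ q /2⌋ (wkᵗ s) v₀) (GT l ⌈ q /2⌉ v₀ (wkᵗ t))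
        (all s≤u u<t)
        (lower-intro s t 0 (subst (_≤ _) (sym (+-identityʳ _)) s≤u) ,
         upper-intro s t 1 (subst (_≤ value ρ t) (+-comm 1 (toℕ u)) u<t))
        (λ y → contradiction u≤ (<⇒≱ (subst (λ a → a + ⌊ q /2⌋ < toℕ u) (value-wkᵗ s)
                 (GT-sound l _ (wkᵗ s) v₀ (≤-trans (*-monoʳ-≤ 4 (⌊n/2⌋≤⌈n/2⌉ q)) (halve-LE l q small)) y))))
        (λ y → contradiction t≤ (<⇒≱ (subst (toℕ u + ⌈ q /2⌉ <_) (value-wkᵗ t)
                 (GT-sound l _ v₀ (wkᵗ t) (halve-LE l q small) y))))
    where
    s≤u : value ρ s ≤ toℕ u
    s≤u = subst (_ ≤_) (sym u≡) (m≤m⊔n _ _)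
    u<t : toℕ u < value ρ t
    u<t = subst (_< _) (sym u≡) (⊔-lub s<t (o<m⇒m∸[1+n]<m ⌊ q′ /2⌋ s<t))
    t≤ : value ρ t ≤ toℕ u + ⌈ q /2⌉
    t≤ = begin
      value ρ t                                         ≤⟨ m≤n+m∸n (value ρ t) ⌈ q /2⌉ ⟩
      ⌈ q /2⌉ + (value ρ t ∸ ⌈ q /2⌉)                   ≤⟨ +-monoʳ-≤ ⌈ q /2⌉ (m≤n⊔m (value ρ s) _) ⟩
      ⌈ q /2⌉ + (value ρ s ⊔ (value ρ t ∸ ⌈ q /2⌉))     ≡⟨ cong (⌈ q /2⌉ +_) u≡ ⟨
      ⌈ q /2⌉ + toℕ u                                   ≡⟨ +-comm ⌈ q /2⌉ _ ⟩
      toℕ u + ⌈ q /2⌉                                   ∎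
    u≤ : toℕ u ≤ value ρ s + ⌊ q /2⌋
    u≤ = subst (_≤ value ρ s + ⌊ q /2⌋) (sym u≡) (⊔-lub (m≤m+n _ _) (m≤n+o⇒m∸n≤o _ ⌈ q /2⌉ (begin
      value ρ t                          ≤⟨ t≤s+q ⟩
      value ρ s + q                      ≡⟨ cong (value ρ s +_) (⌊n/2⌋+⌈n/2⌉≡n q) ⟨
      value ρ s + (⌊ q /2⌋ + ⌈ q /2⌉)    ≡⟨ +-assoc (value ρ s) _ _ ⟨
      value ρ s + ⌊ q /2⌋ + ⌈ q /2⌉      ≡⟨ +-comm _ ⌈ q /2⌉ ⟩
      ⌈ q /2⌉ + (value ρ s + ⌊ q /2⌋)    ∎)))

-- Order types of tuples

SameOrder : ∀ {k m n} → (Fin k → Fin m) → (Fin k → Fin n) → Set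
SameOrder σ τ = ∀ i j → (σ i Fin.< σ j) ⇔ (τ i Fin.< τ j)

-- Decoding of the Lehmer code: `remQuot` splits off the leading digit in the factorial number
-- system, which is the first value, and `punchIn` arranges the other values around it.
perm : ∀ m → Fin (m !) → Fin m → Fin m
perm (suc m) c zero    = proj₁ (remQuot (m !) c)
perm (suc m) c (suc x) = punchIn (proj₁ (remQuot {suc m} (m !) c)) (perm m (proj₂ (remQuot {suc m} (m !) c)) x)

perm-surjective : ∀ m c y → ∃[ x ] perm m c x ≡ y
perm-surjective (suc m) c y with proj₁ (remQuot {suc m} (m !) c) Fin.≟ y
... | yes r≡y = zero , r≡y
... | no  r≢y with perm-surjective m (proj₂ (remQuot {suc m} (m !) c)) (punchOut r≢y)
...   | x , eq = suc x , trans (cong (punchIn _) eq) (punchIn-punchOut r≢y)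

punchIn-< : ∀ {n} i {j k : Fin n} → (j Fin.< k) ⇔ (punchIn i j Fin.< punchIn i k)
punchIn-< i = mk⇔ (λ j<k → ≰⇒> (<⇒≱ j<k ∘ punchIn-cancel-≤ i _ _))
                  (λ j<k → ≰⇒> (<⇒≱ j<k ∘ punchIn-mono-≤ i _ _))

punchIn<⇒< : ∀ {n} (i : Fin (suc n)) (j : Fin n) → punchIn i j Fin.< i → toℕ j < toℕ i
punchIn<⇒< (suc i) zero    _         = z<s
punchIn<⇒< (suc i) (suc j) (s<s j<i) = s<s (punchIn<⇒< i j j<i)

<⇒punchIn< : ∀ {n} (i : Fin (suc n)) (j : Fin n) → toℕ j < toℕ i → punchIn i j Fin.< i
<⇒punchIn< (suc i) zero    _         = z<s
<⇒punchIn< (suc i) (suc j) (s<s j<i) = s<s (<⇒punchIn< i j j<i)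

-- If r < s, the argument at which σ takes the value r tells them apart.
inserted-≮ : ∀ {m} (σ : Fin m → Fin m) → (∀ y → ∃[ x ] σ x ≡ y) → (r s : Fin (suc m)) →
             (∀ x → punchIn s (σ x) Fin.< s → punchIn r (σ x) Fin.< r) → ¬ r Fin.< s
inserted-≮ σ surj r s imp r<s with below′
  where
  below′ : ∃[ y ] toℕ y ≡ toℕ r
  below′ = Fin.fromℕ< (≤-trans r<s (s≤s⁻¹ (toℕ<n s))) , Fin.toℕ-fromℕ< _
... | y , y≡r with surj y
...   | x , refl = <-irrefl y≡r (punchIn<⇒< r (σ x) (imp x (<⇒punchIn< s (σ x) (subst (_< toℕ s) (sym y≡r) r<s))))

-- The tails have the same order because `punchIn` is strictly monotone, so the remaining digits
-- agree by induction. The leading digits are then compared through this common tail: the same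
-- entries lie below the first value.
perm-injective : ∀ m c d → SameOrder (perm m c) (perm m d) → c ≡ d
perm-injective zero    zero zero _    = refl
perm-injective (suc m) c d same =
  trans (sym (combine-remQuot {suc m} (m !) c))
        (trans (cong₂ combine r≡s i≡j) (combine-remQuot {suc m} (m !) d))
  where
  r = proj₁ (remQuot {suc m} (m !) c)
  i = proj₂ (remQuot {suc m} (m !) c)
  s = proj₁ (remQuot {suc m} (m !) d)
  j = proj₂ (remQuot {suc m} (m !) d)
  i≡j : i ≡ j
  i≡j = perm-injective m i j λ x y →
    ⇔-trans (punchIn-< r) (⇔-trans (same (suc x) (suc y)) (⇔-sym (punchIn-< s)))
  r≮s : ¬ r Fin.< s
  r≮s = inserted-≮ (perm m i) (perm-surjective m i) r s λ x lt →
    from (same (suc x) zero) (subst (λ i → punchIn s (perm m i x) Fin.< s) i≡j lt)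
  s≮r : ¬ s Fin.< r
  s≮r = inserted-≮ (perm m i) (perm-surjective m i) s r λ x lt →
    subst (λ i → punchIn s (perm m i x) Fin.< s) (sym i≡j) (to (same (suc x) zero) lt)
  r≡s : r ≡ s
  r≡s with Fin.<-cmp r s
  ... | tri< r<s _ _ = contradiction r<s r≮s
  ... | tri≈ _ eq _  = eq
  ... | tri> _ _ s<r = contradiction s<r s≮r

increasing-≥ : ∀ {n} (f : Fin n → ℕ) b → (∀ {i j} → i Fin.< j → f i < f j) →
               (∀ i → b ≤ f i) → ∀ i → b + toℕ i ≤ f i
increasing-≥ f b inc b≤f zero    = subst (_≤ f zero) (sym (+-identityʳ b)) (b≤f zero)
increasing-≥ f b inc b≤f (suc i) = subst (_≤ f (suc i)) (sym (+-suc b (toℕ i)))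
  (increasing-≥ (f ∘ suc) (suc b) (inc ∘ s<s) (λ j → ≤-<-trans (b≤f zero) (inc z<s)) i)

increasing-≤ : ∀ {n} (f : Fin n → ℕ) b → (∀ {i j} → i Fin.< j → f i < f j) →
               (∀ i → f i < b) → ∀ i → f i + (n ∸ toℕ i) ≤ b
increasing-≤ {suc zero}    f b inc f<b zero    = subst (_≤ b) (+-comm 1 (f zero)) (f<b zero)
increasing-≤ {suc (suc n)} f b inc f<b zero    = ≤-trans
  (≤-trans (≤-reflexive (+-suc (f zero) (suc n))) (+-monoˡ-≤ (suc n) (inc z<s)))
  (increasing-≤ (f ∘ suc) b (inc ∘ s<s) (f<b ∘ suc) zero)
increasing-≤ {suc n}       f b inc f<b (suc i) = increasing-≤ (f ∘ suc) b (inc ∘ s<s) (f<b ∘ suc) i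

-- The i values before `f i` and the n - 1 - i values after it squeeze `f i` to i. Hence an
-- increasing tuple of n positions in a string of length n lists all of them.
increasing⇒id : ∀ {n} (f : Fin n → Fin n) → (∀ {i j} → i Fin.< j → f i Fin.< f j) → ∀ i → f i ≡ i
increasing⇒id {n} f inc i = toℕ-injective (≤-antisym
  (+-cancelʳ-≤ (n ∸ toℕ i) (toℕ (f i)) (toℕ i)
    (subst (toℕ (f i) + (n ∸ toℕ i) ≤_) (sym (m+[n∸m]≡n (<⇒≤ (toℕ<n i))))
      (increasing-≤ (toℕ ∘ f) n inc (toℕ<n ∘ f) i)))
  (increasing-≥ (toℕ ∘ f) 0 inc (λ _ → z≤n) i))

-- Formulas for order types and case distinctions

⋀ : ∀ {k} n → (Fin n → Matrix k) → Matrix k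
⋀ zero    p = ⊤ᵐ
⋀ (suc n) p = p zero ∧ᵐ ⋀ n (p ∘ suc)

signed : ∀ {k} {P : Set} → Dec P → Matrix k → Matrix k
signed (yes _) p = p
signed (no _)  p = ¬ᵐ p

orderType : ∀ {k m} → (Fin k → Fin m) → Matrix k
orderType {k} σ = ⋀ k λ i → ⋀ k λ j → signed (σ i <? σ j) (var i <ᵐ var j)

match : ∀ {l k} n → (Fin n → Matrix k) → (Fin n → Alternating l k) → Alternating l k
-- A tuple that meets none of the conditions imposes nothing.
match {l} zero c A = verum l
match (suc n)  c A = if c zero then A zero else match n (c ∘ suc) (A ∘ suc)

module MatrixSemantics {m} (w : Vec Bool (suc m)) where
  open Semantics w

  ⊩-⋀ : ∀ {k} {ρ : Vec U k} n p → (ρ ⊩ ⋀ n p) ⇔ (∀ i → ρ ⊩ p i)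
  ⊩-⋀ zero    p = mk⇔ (λ _ ()) (λ _ → refl)
  ⊩-⋀ (suc n) p = mk⇔ (λ { (y , ys) zero → y ; (y , ys) (suc i) → to (⊩-⋀ n (p ∘ suc)) ys i })
                      (λ ys → ys zero , from (⊩-⋀ n (p ∘ suc)) (ys ∘ suc))

  ⊩-signed : ∀ {k} {ρ : Vec U k} {P : Set} (P? : Dec P) p → (ρ ⊩ signed P? p) ⇔ (P ⇔ (ρ ⊩ p))
  ⊩-signed (yes P) p = mk⇔ (λ y → mk⇔ (λ _ → y) (λ _ → P)) (λ eq → to eq P)
  ⊩-signed (no ¬P) p = mk⇔ (λ n → mk⇔ (λ P → contradiction P ¬P) (λ y → contradiction y n)) (λ eq → ¬P ∘ from eq)

  ⊩-orderType : ∀ {k n} {ρ : Vec U k} (σ : Fin k → Fin n) →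
                (ρ ⊩ orderType σ) ⇔ SameOrder σ (lookup ρ)
  ⊩-orderType {k} σ = mk⇔
    (λ y i j → to (⊩-signed (σ i <? σ j) (var i <ᵐ var j)) (to (⊩-⋀ k _) (to (⊩-⋀ k _) y i) j))
    (λ same → from (⊩-⋀ k _) λ i → from (⊩-⋀ k _) λ j → from (⊩-signed (σ i <? σ j) (var i <ᵐ var j)) (same i j))

  match-intro : ∀ {l k} {ρ : Vec U k} n c (A : Fin n → Alternating l k) →
                (∀ i → ρ ⊩ᵃ A i) → ρ ⊩ᵃ match n c A
  match-intro {l} zero c A ys = ⊩-verum l
  match-intro {ρ = ρ} (suc n)  c A ys with ⊩? ρ (c zero)
  ... | yes y = from (if-true (c zero) (A zero) (match n (c ∘ suc) (A ∘ suc)) y) (ys zero)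
  ... | no n′ = from (if-false (c zero) (A zero) (match n (c ∘ suc) (A ∘ suc)) n′)
                  (match-intro n (c ∘ suc) (A ∘ suc) (ys ∘ suc))

  -- `match` stops at the first condition that holds; uniqueness guarantees that no earlier case
  -- intercepts case `i`.
  match-elim : ∀ {l k} {ρ : Vec U k} n c (A : Fin n → Alternating l k) → ρ ⊩ᵃ match n c A →
               ∀ i → ρ ⊩ c i → (∀ j → ρ ⊩ c j → j ≡ i) → ρ ⊩ᵃ A i
  match-elim (suc n) c A y zero    ci uniq = to (if-true (c zero) (A zero) (match n (c ∘ suc) (A ∘ suc)) ci) y
  match-elim (suc n) c A y (suc i) ci uniq =
    match-elim n (c ∘ suc) (A ∘ suc)
      (to (if-false (c zero) (A zero) _ λ c0 → Fin.0≢1+n (uniq zero c0)) y) i ci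
      (λ j cj → Fin.suc-injective (uniq (suc j) cj))

-- Blocks of universal quantifiers

∀⋯∀ : ∀ k → Formula k → Sentence
∀⋯∀ zero    φ = φ
∀⋯∀ (suc k) φ = ∀⋯∀ k (∀′ φ)

quantifiers-∀⋯∀ : ∀ k φ → quantifiers (∀⋯∀ k φ) ≡ k + quantifiers φ
quantifiers-∀⋯∀ zero    φ = refl
quantifiers-∀⋯∀ (suc k) φ = trans (quantifiers-∀⋯∀ k (∀′ φ)) (+-suc k _)

⊨-∀⋯∀ : ∀ 𝐀 k {φ} → (𝐀 ⊨ ∀⋯∀ k φ) ⇔ (∀ ρ → Sat 𝐀 ρ φ)
⊨-∀⋯∀ 𝐀 zero    = mk⇔ (λ { y [] → y }) (λ ys → ys [])
⊨-∀⋯∀ 𝐀 (suc k) = mk⇔ (λ { y (a ∷ ρ) → to (⊨-∀⋯∀ 𝐀 k) y ρ a })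
                      (λ ys → from (⊨-∀⋯∀ 𝐀 k) λ ρ a → ys (a ∷ ρ))

-- Sentences separating strings

letter : ∀ {n k} → Vec Bool n → Fin n → Term k → Matrix k
letter w i t = signed (lookup w i ≟ᵇ true) (Sᵐ t)

≡true⇔⇒≡ : ∀ a b → ((a ≡ true) ⇔ (b ≡ true)) → a ≡ b
≡true⇔⇒≡ true  b     eq = sym (to eq refl)
≡true⇔⇒≡ false true  eq = from eq refl
≡true⇔⇒≡ false false eq = refl

⊩-letter : ∀ {m k} (w w′ : Vec Bool (suc m)) i (t : Term k) ρ →
           Semantics._⊩_ w′ ρ (letter w i t) ⇔ (lookup w i ≡ lookup w′ (⟦ 𝐁 w′ ⟧ t ρ))
⊩-letter w w′ i t ρ = ⇔-trans (MatrixSemantics.⊩-signed w′ (lookup w i ≟ᵇ true) (Sᵐ t))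
  (mk⇔ (≡true⇔⇒≡ _ _) (λ eq → mk⇔ (trans (sym eq)) (trans eq)))

differ : ∀ {n} (w w′ : Vec Bool n) → w ≢ w′ → ∃[ i ] lookup w i ≢ lookup w′ i
differ {n} w w′ w≢w′ = ¬∀⟶∃¬ n _ (λ i → lookup w i ≟ᵇ lookup w′ i) λ all →
  w≢w′ (trans (sym (tabulate∘lookup w)) (trans (tabulate-cong all) (tabulate∘lookup w′)))

-- The two distances add up to `m`, the distance from `min` to `max`, which leaves `i` as the only
-- position for z.
letterAt : ∀ {m k} l → Vec Bool (suc m) → Fin (suc m) → Alternating (suc l) k
letterAt {m} l w i = split l (toℕ i) (m ∸ toℕ i) (letter w i v₀) min max

letterAt-complete : ∀ {m k} l (w : Vec Bool (suc m)) i {ρ : Vec (Fin (suc m)) k} →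
                    Semantics._⊩ᵃ_ w ρ (letterAt l w i)
letterAt-complete {m} l w i {ρ} = forget (letterAt l w i)
  -- The location of the witness is irrelevant here, hence a trivially true predicate `P`.
  (split-complete l (toℕ i) (m ∸ toℕ i) (letter w i v₀) min max {P = λ z → z ≡ z} {z = i} refl ≤-refl
    (≤-reflexive (trans (m+[n∸m]≡n (s≤s⁻¹ (toℕ<n i))) (sym (toℕ-fromℕ m))))
    (from (⊩-letter w w i v₀ (i ∷ ρ)) refl))
  where open Semantics w

letterAt-sound : ∀ {m k} l (w w′ : Vec Bool (suc m)) i {ρ : Vec (Fin (suc m)) k} → 4 * m ≤ 1 + 2 ^ l →
                 Semantics._⊩ᵃ_ w′ ρ (letterAt l w i) → lookup w i ≡ lookup w′ i
letterAt-sound {m} l w w′ i {ρ} small y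
  with split-sound l (toℕ i) (m ∸ toℕ i) (letter w i v₀) min max
         (≤-trans (*-monoʳ-≤ 4 (≤-trans (pred[n]≤n {toℕ i}) (s≤s⁻¹ (toℕ<n i)))) small)
         (≤-trans (*-monoʳ-≤ 4 (≤-trans (pred[n]≤n {m ∸ toℕ i}) (m∸n≤m m (toℕ i)))) small) y
  where open Semantics w′
... | z , i≤z , z≤i , yl with toℕ-injective (≤-antisym z≤i′ i≤z)
  where
  z≤i′ : toℕ z ≤ toℕ i
  z≤i′ = +-cancelʳ-≤ (m ∸ toℕ i) (toℕ z) (toℕ i)
    (subst (toℕ z + (m ∸ toℕ i) ≤_) (trans (toℕ-fromℕ m) (sym (m+[n∸m]≡n (s≤s⁻¹ (toℕ<n i))))) z≤i)
...   | refl = to (⊩-letter w w′ i v₀ (z ∷ ρ)) yl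

Separates : ∀ {m} → Sentence → Vec Bool (suc m) → List (Vec Bool (suc m)) → Set
Separates φ w ℬ = 𝐁 w ⊨ φ × (∀ w′ → w′ ∈ ℬ → ¬ (𝐁 w′ ⊨ φ))

-- The sentence says that every increasing tuple of n = m + 1 positions carries the letters of `w`.
-- Such a tuple lists all positions, and in w′ it exposes the letter that differs.
separate-by-description : ∀ {m} (w : Vec Bool (suc m)) ℬ → w ∉ ℬ →
                          ∃[ φ ] quantifiers φ ≡ suc m × Separates φ w ℬ
separate-by-description {m} w ℬ w∉ℬ = φ , q , yes-w , no-w′
  where
  n = suc m
  own-letter : Fin n → Matrix n
  own-letter i = letter w i (var i)

  letters description : Matrix n
  letters     = ⋀ n own-letter
  description = ¬ᵐ orderType {n} id ∨ᵐ letters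
  φ = ∀⋯∀ n ⌜ description ⌝

  q : quantifiers φ ≡ n
  q = trans (quantifiers-∀⋯∀ n ⌜ description ⌝) (trans (cong (n +_) (quantifiers-⌜⌝ description)) (+-identityʳ n))

  yes-w : 𝐁 w ⊨ φ
  yes-w = from (⊨-∀⋯∀ (𝐁 w) n) holds
    where
    open Semantics w
    open MatrixSemantics w
    holds : ∀ ρ → ρ ⊩ description
    holds ρ with ⊩? ρ (orderType {n} id)
    ... | no  n′ = inj₁ n′
    ... | yes y = inj₂ (from (⊩-⋀ n own-letter) λ i → from (⊩-letter w w i (var i) ρ)
                    (cong (lookup w) (sym (increasing⇒id (lookup ρ) (λ {i j} → to (to (⊩-orderType id) y i j)) i))))

  no-w′ : ∀ w′ → w′ ∈ ℬ → ¬ (𝐁 w′ ⊨ φ)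
  no-w′ w′ w′∈ℬ y with differ w w′ (λ { refl → w∉ℬ w′∈ℬ }) | to (⊨-∀⋯∀ (𝐁 w′) n) y (tabulate id)
  ... | i , wi≢w′i | inj₁ no-type = no-type (from (MatrixSemantics.⊩-orderType w′ {ρ = tabulate id} id) λ i j →
          subst₂ (λ a b → (i Fin.< j) ⇔ (a Fin.< b)) (sym (lookup∘tabulate id i)) (sym (lookup∘tabulate id j))
            (mk⇔ id id))
  ... | i , wi≢w′i | inj₂ ys =
          wi≢w′i (trans (to (⊩-letter w w′ i (var i) (tabulate id)) (to (MatrixSemantics.⊩-⋀ w′ n own-letter) ys i))
          (cong (lookup w′) (lookup∘tabulate id i)))

-- The three bounds ensure, in turn, that every permutation of k values is realised by positions,
-- that the entries of `ℬ` get distinct order types, and that bisection is exact on strings of this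
-- length.
separate-by-order-types : ∀ {m} k l (w : Vec Bool (suc m)) ℬ → w ∉ ℬ →
                          k ≤ suc m → length ℬ ≤ k ! → 4 * m ≤ 1 + 2 ^ l →
                          ∃[ φ ] quantifiers φ ≡ k + suc l × Separates φ w ℬ
separate-by-order-types {m} k l w ℬ w∉ℬ k≤n ℬ≤k! small = φ , q , yes-w , no-w′
  where
  n = suc m

  type : Fin (length ℬ) → Fin k → Fin k
  type b = perm k (inject≤ b ℬ≤k!)

  position : Fin (length ℬ) → Fin n
  position b = proj₁ (differ w (List.lookup ℬ b) λ { refl → w∉ℬ (∈-lookup b) })

  body : Alternating (suc l) k
  body = match (length ℬ) (orderType ∘ type) (letterAt l w ∘ position)

  φ = ∀⋯∀ k ⌊ body ⌋

  q : quantifiers φ ≡ k + suc l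
  q = trans (quantifiers-∀⋯∀ k ⌊ body ⌋) (cong (k +_) (quantifiers-⌊⌋ body))

  yes-w : 𝐁 w ⊨ φ
  -- All the letter claims are true in `w`, so it does not matter which case a tuple falls under.
  yes-w = from (⊨-∀⋯∀ (𝐁 w) k) λ ρ →
    MatrixSemantics.match-intro w (length ℬ) (orderType ∘ type) (letterAt l w ∘ position)
      λ b → letterAt-complete l w (position b)

  no-lookup : ∀ b → ¬ (𝐁 (List.lookup ℬ b) ⊨ φ)
  no-lookup b y = proj₂ (differ w w′ λ { refl → w∉ℬ (∈-lookup b) })
    (letterAt-sound l w w′ (position b) small
      (match-elim (length ℬ) (orderType ∘ type) (letterAt l w ∘ position) (to (⊨-∀⋯∀ (𝐁 w′) k) y ρ)
        b (from (⊩-orderType (type b)) ρ-type) unique))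
    where
    w′ = List.lookup ℬ b
    open Semantics w′
    open MatrixSemantics w′
    ρ : Vec U k
    -- The refuting tuple is the permutation assigned to w′, with its values read as positions.
    ρ = tabulate λ x → inject≤ (type b x) k≤n
    toℕ-ρ : ∀ x → toℕ (lookup ρ x) ≡ toℕ (type b x)
    toℕ-ρ x = trans (cong toℕ (lookup∘tabulate _ x)) (toℕ-inject≤ (type b x) k≤n)
    ρ-type : SameOrder (type b) (lookup ρ)
    ρ-type x y = mk⇔ (subst₂ _<_ (sym (toℕ-ρ x)) (sym (toℕ-ρ y))) (subst₂ _<_ (toℕ-ρ x) (toℕ-ρ y))
    unique : ∀ c → ρ ⊩ orderType (type c) → c ≡ b
    unique c yc = Fin.inject≤-injective ℬ≤k! ℬ≤k! c b (perm-injective k _ _ λ x y →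
      ⇔-trans (to (⊩-orderType (type c)) yc x y) (⇔-sym (ρ-type x y)))

  no-w′ : ∀ w′ → w′ ∈ ℬ → ¬ (𝐁 w′ ⊨ φ)
  no-w′ w′ w′∈ℬ = subst (λ v → ¬ (𝐁 v ⊨ φ)) (sym (lookup-index w′∈ℬ)) (no-lookup (index w′∈ℬ))

-- m! ≥ (m / e)^m

-- k! times the k-th partial sum of e
eNum : ℕ → ℕ
eNum zero    = 1
eNum (suc k) = suc k * eNum k + 1

-- n^k k! times the k-th partial sum of exp (j / n)
expNum : ℕ → ℕ → ℕ → ℕ
expNum n j zero    = 1
expNum n j (suc k) = suc k * n * expNum n j k + j ^ suc k

-- The first two terms of the binomial expansion of (j + 1)^(k + 1).
bernoulli : ∀ j k → j ^ suc k + suc k * j ^ k ≤ suc j ^ suc k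
bernoulli j zero    = ≤-reflexive (lemma j)
  where
  lemma : ∀ j → j * 1 + 1 * 1 ≡ suc j * 1
  lemma = solve-∀
bernoulli j (suc k) = begin
  j * (j * x) + suc (suc k) * (j * x)                     ≤⟨ m≤m+n _ (suc k * x) ⟩
  j * (j * x) + suc (suc k) * (j * x) + suc k * x         ≡⟨ lemma j k x ⟩
  suc j * (j * x + suc k * x)                             ≤⟨ *-monoʳ-≤ (suc j) (bernoulli j k) ⟩
  suc j * suc j ^ suc k                                   ∎
  where
  x = j ^ k
  lemma : ∀ j k x → j * (j * x) + suc (suc k) * (j * x) + suc k * x ≡ suc j * (j * x + suc k * x)
  lemma = solve-∀

-- exp (j / n) + exp (j / n) / n ≤ exp ((j + 1) / n)
expNum-suc : ∀ n j k → expNum n j (suc k) + suc k * expNum n j k ≤ expNum n (suc j) (suc k)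
expNum-suc n j zero    = ≤-reflexive (lemma n j)
  where
  lemma : ∀ n j → 1 * n * 1 + j * 1 + 1 * 1 ≡ 1 * n * 1 + suc j * 1
  lemma = solve-∀
expNum-suc n j (suc k) = begin
  2+k * n * u′ + j ^ suc (suc k) + 2+k * (suc k * n * u + j ^ suc k)
    ≡⟨ lemma n k u u′ (j ^ suc k) (j ^ suc (suc k)) ⟩
  2+k * n * (u′ + suc k * u) + (j ^ suc (suc k) + 2+k * j ^ suc k)
    ≤⟨ +-mono-≤ (*-monoʳ-≤ (2+k * n) (expNum-suc n j k)) (bernoulli j (suc k)) ⟩
  2+k * n * expNum n (suc j) (suc k) + suc j ^ suc (suc k)                      ∎
  where
  2+k = suc (suc k)
  u   = expNum n j k
  u′  = expNum n j (suc k)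
  lemma : ∀ n k u u′ x y → suc (suc k) * n * u′ + y + suc (suc k) * (suc k * n * u + x) ≡
                           suc (suc k) * n * (u′ + suc k * u) + (y + suc (suc k) * x)
  lemma = solve-∀

-- For n ≥ 1 and divided by n^j j!, this bounds (1 + 1/n)^j by the j-th partial sum of exp (j / n):
-- by `expNum-suc`, raising j by 1 and taking one more term gains at least the factor 1 + 1/n.
expNum-≥ : ∀ n j → j ! * suc n ^ j ≤ expNum n j j
expNum-≥ n zero    = ≤-refl
expNum-≥ n (suc j) = begin
  suc j * j ! * (suc n * suc n ^ j)                               ≡⟨ lemma₁ j n (j !) (suc n ^ j) ⟩
  suc j * suc n * (j ! * suc n ^ j)                               ≤⟨ *-monoʳ-≤ (suc j * suc n) (expNum-≥ n j) ⟩
  suc j * suc n * expNum n j j                                    ≤⟨ m≤m+n _ (j ^ suc j) ⟩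
  suc j * suc n * expNum n j j + j ^ suc j                        ≡⟨ lemma₂ j n (expNum n j j) (j ^ suc j) ⟩
  suc j * n * expNum n j j + j ^ suc j + suc j * expNum n j j     ≤⟨ expNum-suc n j j ⟩
  expNum n (suc j) (suc j)                                        ∎
  where
  lemma₁ : ∀ j n x y → suc j * x * (suc n * y) ≡ suc j * suc n * (x * y)
  lemma₁ = solve-∀
  lemma₂ : ∀ j n u y → suc j * suc n * u + y ≡ suc j * n * u + y + suc j * u
  lemma₂ = solve-∀

-- For j = n the argument j / n is 1, and the partial sums become those of e.
expNum-diagonal : ∀ n k → expNum n n k ≡ n ^ k * eNum k
expNum-diagonal n zero    = refl
expNum-diagonal n (suc k) = trans (cong (λ u → suc k * n * u + n ^ suc k) (expNum-diagonal n k))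
                                  (lemma k n (n ^ k) (eNum k))
  where
  lemma : ∀ k n x p → suc k * n * (x * p) + n * x ≡ n * x * (suc k * p + 1)
  lemma = solve-∀

eNum-mono : ∀ {n k} → n ≤′ k → k ! * eNum n ≤ n ! * eNum k
eNum-mono ≤′-refl           = ≤-refl
eNum-mono {n} {suc k} (≤′-step n≤k) = begin
  suc k * k ! * eNum n              ≡⟨ *-assoc (suc k) (k !) (eNum n) ⟩
  suc k * (k ! * eNum n)            ≤⟨ *-monoʳ-≤ (suc k) (eNum-mono n≤k) ⟩
  suc k * (n ! * eNum k)            ≤⟨ m≤m+n _ (n !) ⟩
  suc k * (n ! * eNum k) + n !      ≡⟨ lemma k (n !) (eNum k) ⟩
  n ! * (suc k * eNum k + 1)        ∎
  where
  lemma : ∀ k x p → suc k * (x * p) + x ≡ x * (suc k * p + 1)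
  lemma = solve-∀

-- (1 + 1 / n)^n ≤ e
[1+n]^n*k!≤n^n*eNum : ∀ {n k} → n ≤ k → suc n ^ n * k ! ≤ n ^ n * eNum k
[1+n]^n*k!≤n^n*eNum {n} {k} n≤k = *-cancelˡ-≤ (n !) {{n !≢0}} (begin
  n ! * (suc n ^ n * k !)     ≡⟨ *-assoc (n !) (suc n ^ n) (k !) ⟨
  n ! * suc n ^ n * k !       ≤⟨ *-monoˡ-≤ (k !) (subst (n ! * suc n ^ n ≤_) (expNum-diagonal n n) (expNum-≥ n n)) ⟩
  n ^ n * eNum n * k !        ≡⟨ lemma₁ (n ^ n) (eNum n) (k !) ⟩
  n ^ n * (k ! * eNum n)      ≤⟨ *-monoʳ-≤ (n ^ n) (eNum-mono (≤⇒≤′ n≤k)) ⟩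
  n ^ n * (n ! * eNum k)      ≡⟨ lemma₂ (n ^ n) (n !) (eNum k) ⟩
  n ! * (n ^ n * eNum k)      ∎)
  where
  lemma₁ : ∀ x p q → x * p * q ≡ x * (q * p)
  lemma₁ = solve-∀
  lemma₂ : ∀ x y p → x * (y * p) ≡ y * (x * p)
  lemma₂ = solve-∀

-- j^j ≤ j! e^j
stirling : ∀ {k} j → j ≤ k → j ^ j * (k !) ^ j ≤ j ! * eNum k ^ j
stirling     zero    _   = ≤-refl
stirling {k} (suc j) j<k = begin
  suc j * suc j ^ j * (k ! * (k !) ^ j)         ≡⟨ lemma₁ (suc j) (suc j ^ j) (k !) ((k !) ^ j) ⟩
  suc j * (suc j ^ j * k !) * (k !) ^ j
    -- From j to j + 1 the quotient j^j / j! grows by the factor (1 + 1/j)^j, which is at most e.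
    ≤⟨ *-monoˡ-≤ ((k !) ^ j) (*-monoʳ-≤ (suc j) ([1+n]^n*k!≤n^n*eNum (<⇒≤ j<k))) ⟩
  suc j * (j ^ j * eNum k) * (k !) ^ j          ≡⟨ lemma₂ (suc j) (j ^ j) (eNum k) ((k !) ^ j) ⟩
  suc j * eNum k * (j ^ j * (k !) ^ j)          ≤⟨ *-monoʳ-≤ (suc j * eNum k) (stirling j (<⇒≤ j<k)) ⟩
  suc j * eNum k * (j ! * eNum k ^ j)           ≡⟨ lemma₃ (suc j) (eNum k) (j !) (eNum k ^ j) ⟩
  suc j * j ! * (eNum k * eNum k ^ j)           ∎
  where
  lemma₁ : ∀ a x y z → a * x * (y * z) ≡ a * (x * y) * z
  lemma₁ = solve-∀
  lemma₂ : ∀ a x p z → a * (x * p) * z ≡ a * p * (x * z)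
  lemma₂ = solve-∀
  lemma₃ : ∀ a p x y → a * p * (x * y) ≡ a * x * (p * y)
  lemma₃ = solve-∀

*-^ : ∀ a b n → (a * b) ^ n ≡ a ^ n * b ^ n
*-^ a b zero    = refl
*-^ a b (suc n) = trans (cong (a * b *_) (*-^ a b n)) (lemma a b (a ^ n) (b ^ n))
  where
  lemma : ∀ a b x y → a * b * (x * y) ≡ a * x * (b * y)
  lemma = solve-∀

eNum>0 : ∀ k → 0 < eNum k
eNum>0 zero    = z<s
eNum>0 (suc k) = m≤n+m 1 (suc k * eNum k)

-- With e′ the m-th partial sum of e, the hypothesis reads t e′ ≤ m, so that t^m ≤ (m / e′)^m ≤ m!.
power≤factorial : ∀ t m → t * eNum m ≤ m * m ! → t ^ m ≤ m !
power≤factorial t m te≤m = *-cancelʳ-≤ (t ^ m) (m !) (eNum m ^ m)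
  {{m^n≢0 (eNum m) m {{>-nonZero (eNum>0 m)}}}} (begin
  t ^ m * eNum m ^ m      ≡⟨ *-^ t (eNum m) m ⟨
  (t * eNum m) ^ m        ≤⟨ ^-monoˡ-≤ m te≤m ⟩
  (m * m !) ^ m           ≡⟨ *-^ m (m !) m ⟩
  m ^ m * (m !) ^ m       ≤⟨ stirling m ≤-refl ⟩
  m ! * eNum m ^ m        ∎)

2^m≤[1+m]! : ∀ m → 2 ^ m ≤ suc m !
2^m≤[1+m]! zero    = ≤-refl
2^m≤[1+m]! (suc m) = *-mono-≤ {2} {suc (suc m)} (s≤s (s≤s z≤n)) (2^m≤[1+m]! m)

-- Bounds by rational and real numbers

infix 7 _÷_

-- Meant for d ≥ 1: here n ÷ 0 = n ÷ 1.
_÷_ : ℕ → ℕ → ℚᵘ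
n ÷ d = mkℚᵘ (ℤ.+ n) (pred d)

÷-< : ∀ {m n d e} .{{_ : NonZero d}} .{{_ : NonZero e}} → m * e < n * d → m ÷ d ℚ.< n ÷ e
÷-< {m} {n} {suc d} {suc e} lt = *<* (subst₂ ℤ._<_ (ℤ.pos-* m (suc e)) (ℤ.pos-* n (suc d)) (ℤ.+<+ lt))

÷-≤ : ∀ {m n d e} .{{_ : NonZero d}} .{{_ : NonZero e}} → m * e ≤ n * d → m ÷ d ℚ.≤ n ÷ e
÷-≤ {m} {n} {suc d} {suc e} le = *≤* (subst₂ ℤ._≤_ (ℤ.pos-* m (suc e)) (ℤ.pos-* n (suc d)) (ℤ.+≤+ le))

÷-≃ : ∀ {m n d e} .{{_ : NonZero d}} .{{_ : NonZero e}} → m * e ≡ n * d → m ÷ d ≃ n ÷ e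
÷-≃ {m} {n} {suc d} {suc e} eq = *≡* (trans (sym (ℤ.pos-* m (suc e))) (trans (cong ℤ.+_ eq) (ℤ.pos-* n (suc d))))

÷-+ : ∀ m n d e .{{_ : NonZero d}} .{{_ : NonZero e}} → m ÷ d ℚ.+ n ÷ e ≡ (m * e + n * d) ÷ (d * e)
÷-+ m n (suc d) (suc e) = cong (λ z → mkℚᵘ z (pred (suc d * suc e)))
  (cong₂ ℤ._+_ (sym (ℤ.pos-* m (suc e))) (sym (ℤ.pos-* n (suc d))))

/≡÷ : ∀ n d .{{_ : NonZero d}} → ℤ.+ n ℚ./ d ≡ n ÷ d
/≡÷ n (suc d) = refl

eSum≃ : ∀ k → eSum k ≃ eNum k ÷ k !
eSum≃ zero    = ℚ.≃-refl
eSum≃ (suc k) = ℚ.≃-trans (ℚ.+-cong (eSum≃ k) (ℚ.≃-reflexive (/≡÷ 1 (suc k !) {{suc k !≢0}})))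
  (ℚ.≃-trans (ℚ.≃-reflexive (÷-+ (eNum k) 1 (k !) (suc k !) {{k !≢0}} {{suc k !≢0}}))
    (÷-≃ {{m*n≢0 (k !) (suc k !) {{k !≢0}} {{suc k !≢0}}}} {{suc k !≢0}} (lemma k (k !) (eNum k))))
  where
  lemma : ∀ k f p → (p * (suc k * f) + 1 * f) * (suc k * f) ≡ (suc k * p + 1) * (f * (suc k * f))
  lemma = solve-∀

-- The cut is open, so the next partial sum, which is strictly larger, serves as the witness.
eNum÷k!<e : ∀ k → e (eNum k ÷ k !)
eNum÷k!<e k = suc k , ℚ.<-respʳ-≃ (ℚ.≃-sym (eSum≃ (suc k)))
  (÷-< {{k !≢0}} {{suc k !≢0}} (begin-strict
    eNum k * (suc k * k !)              <⟨ m<m+n _ (1≤n! k) ⟩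
    eNum k * (suc k * k !) + k !        ≡⟨ lemma k (k !) (eNum k) ⟩
    (suc k * eNum k + 1) * k !          ∎))
  where
  lemma : ∀ k f p → p * (suc k * f) + f ≡ (suc k * p + 1) * f
  lemma = solve-∀

-- With e′ the k-th partial sum of e, t e′ lies below e t and is an admissible exponent in `Fits`.
-- Hence t^(t e′) ≤ N ≤ t^m, and t ≥ 2 allows the exponents to be compared.
Fits⇒e*t≤m : ∀ {N t m} → 2 ≤ t → N ≤ t ^ m → Fits N t → ∀ k → t * eNum k ≤ m * k !
Fits⇒e*t≤m {N} {t} {m} 2≤t N≤t^m fits k = ≮⇒≥ λ lt → <⇒≱ (^-monoʳ-< t 2≤t lt) (begin
  t ^ (t * eNum k)              ≤⟨ fits ((t * eNum k) ÷ k !) _ (eNum k ÷ k ! , eNum÷k!<e k , r≃) ⟩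
  N ^ suc (pred (k !))          ≡⟨ cong (N ^_) (suc-pred (k !) {{k !≢0}}) ⟩
  N ^ (k !)                     ≤⟨ ^-monoˡ-≤ (k !) N≤t^m ⟩
  (t ^ m) ^ (k !)               ≡⟨ ^-*-assoc t m (k !) ⟩
  t ^ (m * k !)                 ∎)
  where
  ÷-* : ∀ n d m .{{_ : NonZero d}} → (n ÷ d) ℚ.* (ℤ.+ m ℚ./ 1) ≡ (n * m) ÷ (d * 1)
  ÷-* n (suc d) m = cong (λ z → mkℚᵘ z _) (sym (ℤ.pos-* n m))
  lemma : ∀ t p f → t * p * (f * 1) ≡ p * t * f
  lemma = solve-∀
  r≃ : (t * eNum k) ÷ k ! ≃ (eNum k ÷ k !) ℚ.* (ℤ.+ t ℚ./ 1)
  r≃ = ℚ.≃-trans (÷-≃ {{k !≢0}} {{m*n≢0 (k !) 1 {{k !≢0}}}} (lemma t (eNum k) (k !)))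
                 (ℚ.≃-sym (ℚ.≃-reflexive (÷-* (eNum k) (k !) t {{k !≢0}})))

-- m = ⌈log_b x⌉, where ⌈log_b 0⌉ = 0
IsCeilLog : ℕ → ℕ → ℕ → Set
IsCeilLog b x m = x ≤ b ^ m × (∀ {i} → i < m → b ^ i < x)

-- Raising x by 1 raises the ceiling by at most 1, because 1 + b^m ≤ b^(m + 1).
ceilLog : ∀ b → 2 ≤ b → ∀ x → ∃[ m ] IsCeilLog b x m
ceilLog b 2≤b zero    = 0 , z≤n , λ ()
ceilLog b 2≤b (suc x) with ceilLog b 2≤b x
... | m , x≤b^m , lower with suc x ≤? b ^ m
...   | yes x<b^m = m , x<b^m , λ i<m → m<n⇒m<1+n (lower i<m)
...   | no  x≮b^m = suc m , x<b^1+m , λ i<1+m → s≤s (≤-trans (^-monoʳ-≤ b (s≤s⁻¹ i<1+m)) (s≤s⁻¹ (≰⇒> x≮b^m)))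
  where
  instance _ = >-nonZero (≤-trans (s≤s z≤n) 2≤b)
  x<b^1+m : suc x ≤ b ^ suc m
  x<b^1+m = begin
    1 + x                   ≤⟨ +-mono-≤ (m^n>0 b m) x≤b^m ⟩
    b ^ m + b ^ m           ≡⟨ cong (b ^ m +_) (+-identityʳ (b ^ m)) ⟨
    2 * b ^ m               ≤⟨ *-monoˡ-≤ (b ^ m) 2≤b ⟩
    b * b ^ m               ∎

-- For m ≥ 1, minimality of the ceiling gives b^(m - 1) < x. For m = 0 the bound is 0, and the cut
-- contains no negative rational.
log-≥ : ∀ {b x m r} → 2 ≤ b → IsCeilLog b x m → log b x r → pred m ÷ 1 ℚ.≤ r
log-≥ {m = zero}  {mkℚᵘ (ℤ.+ p) d} _ _ _ = ÷-≤ {0} {p} {1} {suc d} z≤n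
log-≥ {b} {x} {suc m} {mkℚᵘ (ℤ.+ p) d} 2≤b (_ , lower) (_ , x^d<b^p) =
  ÷-≤ {m} {p} {1} {suc d} (≤-trans (≮⇒≥ λ p<md → <-asym x^d<b^p (begin-strict
    b ^ p                 <⟨ ^-monoʳ-< b 2≤b p<md ⟩
    b ^ (m * suc d)       ≡⟨ ^-*-assoc b m (suc d) ⟨
    (b ^ m) ^ suc d       <⟨ ^-monoˡ-< (suc d) (lower ≤-refl) ⟩
    x ^ suc d             ∎)) (≤-reflexive (sym (*-identityʳ p))))

natᵁ-bound : ∀ {q l m C b c x y} → 2 ≤ b → 2 ≤ c → IsCeilLog b x l → IsCeilLog c y m →
             q ≤ pred l + pred m + C → natᵁ q ≤ᵁ log b x +ᵁ log c y +ᵁ natᵁ C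
natᵁ-bound {q} {l} {m} {C} 2≤b 2≤c isl ism q≤ r (s , u , (a , a′ , la , la′ , s≃) , C<u , r≃) =
  -- An element of the cut is a sum of one element for each summand. The two logarithms contribute
  -- weak inequalities, the constant `C` the strict one.
  ℚ.≤-<-trans q≤sum (ℚ.<-respʳ-≃ (ℚ.≃-sym (ℚ.≃-trans r≃ (ℚ.+-congˡ u s≃)))
    (ℚ.+-mono-≤-< (ℚ.+-mono-≤ (log-≥ {r = a} 2≤b isl la) (log-≥ {r = a′} 2≤c ism la′)) C<u))
  where
  lemma : ∀ a b c → (a + b + c) * 1 ≡ (a * 1 + b * 1) * 1 + c * 1
  lemma = solve-∀
  q≤sum : q ÷ 1 ℚ.≤ pred l ÷ 1 ℚ.+ pred m ÷ 1 ℚ.+ C ÷ 1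
  q≤sum = subst (q ÷ 1 ℚ.≤_)
    (trans (sym (÷-+ (pred l * 1 + pred m * 1) C 1 1)) (cong (ℚ._+ C ÷ 1) (sym (÷-+ (pred l) (pred m) 1 1))))
    (÷-≤ {q} {(pred l * 1 + pred m * 1) * 1 + C * 1} {1} {1}
      (*-monoˡ-≤ 1 (subst (q ≤_) (trans (sym (*-identityʳ _)) (lemma (pred l) (pred m) C)) q≤)))

-- The number of quantifiers

IsBase⇒2≤ : ∀ N {t} → IsBase N t → 2 ≤ t
IsBase⇒2≤ N (inj₁ (t₀ , _ , refl)) = m≤m⊔n 2 t₀
IsBase⇒2≤ N (inj₂ (_ , refl))      = ≤-refl

IsBase⇒≤! : ∀ {N t} m → IsBase N t → N ≤ t ^ m → N ≤ suc m !
IsBase⇒≤! m (inj₂ (_ , refl)) N≤2^m = ≤-trans N≤2^m (2^m≤[1+m]! m)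
IsBase⇒≤! m (inj₁ (t₀ , (_ , fits , _) , refl)) N≤t^m with ≤-total t₀ 2
... | inj₁ t₀≤2 rewrite m≥n⇒m⊔n≡m t₀≤2 = ≤-trans N≤t^m (2^m≤[1+m]! m)
... | inj₂ 2≤t₀ rewrite m≤n⇒m⊔n≡n 2≤t₀ = ≤-trans N≤t^m
  -- Here m! already exceeds or equals N; the factor m + 1 makes the bound uniform with the case t =
  -- 2.
  (≤-trans (power≤factorial t₀ m (Fits⇒e*t≤m {m = m} 2≤t₀ N≤t^m fits m)) (m≤n*m (m !) (suc m)))

-- m + 1 universal quantifiers and a prefix of length l + 3 make l + m + 4; replacing l and m by
-- their predecessors costs at most 2 more.
quantifier-count : ∀ l m → suc m + suc (2 + l) ≤ pred l + pred m + 6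
quantifier-count l m = begin
  suc m + suc (2 + l)                          ≤⟨ +-mono-≤ (s≤s (n≤1+pred m)) (s≤s (s≤s (s≤s (n≤1+pred l)))) ⟩
  2 + pred m + (4 + pred l)                    ≡⟨ lemma (pred l) (pred m) ⟩
  pred l + pred m + 6                          ∎
  where
  n≤1+pred : ∀ n → n ≤ suc (pred n)
  n≤1+pred zero    = z≤n
  n≤1+pred (suc n) = ≤-refl
  lemma : ∀ a b → 2 + b + (4 + a) ≡ a + b + 6
  lemma = solve-∀

separate : ∀ {n} N k l (w : Vec Bool (suc n)) ℬ → w ∉ ℬ → length ℬ ≤ N →
           suc n ≤ 2 ^ l → N ≤ suc k ! →
           ∃[ φ ] quantifiers φ ≤ pred l + pred k + 6 × Separates φ w ℬ
separate {n} N k l w ℬ w∉ℬ ℬ≤N n≤2^l N≤k! with suc k ≤? suc n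
... | yes k≤n =
  let φ , q≡ , sep = separate-by-order-types (suc k) (2 + l) w ℬ w∉ℬ k≤n (≤-trans ℬ≤N N≤k!) small
  in φ , subst (_≤ pred l + pred k + 6) (sym q≡) (quantifier-count l k) , sep
  where
  -- The offset 2 in the bisection depth supplies the factor 4 in the size bound.
  small : 4 * n ≤ 1 + 2 ^ (2 + l)
  small = begin
    4 * n                 ≤⟨ *-monoʳ-≤ 4 (<⇒≤ n≤2^l) ⟩
    4 * 2 ^ l             ≡⟨ *-assoc 2 2 (2 ^ l) ⟩
    2 ^ (2 + l)           ≤⟨ n≤1+n _ ⟩
    1 + 2 ^ (2 + l)       ∎
... | no k≰n =
  let φ , q≡ , sep = separate-by-description w ℬ w∉ℬ
  in φ , subst (_≤ pred l + pred k + 6) (sym q≡)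
           (≤-trans (<⇒≤ (≰⇒> k≰n)) (≤-trans (m≤m+n (suc k) _) (quantifier-count l k))) , sep

mainTheorem14 : ∃[ C ] ∀ (f : ℕ → ℕ) (N t : ℕ) → IsMaximum f N → IsBase N t →
    ∀ (n : ℕ) .{{_ : NonZero n}} (w : Vec Bool n) (ℬ : List (Vec Bool n)) →
    Unique ℬ → w ∉ ℬ → length ℬ ≡ f n →
    ∃[ φ ] natᵁ (quantifiers φ) ≤ᵁ log 2 n +ᵁ log t N +ᵁ natᵁ C
    × 𝐁 w ⊨ φ
    × (∀ w′ → w′ ∈ ℬ → ¬ (𝐁 w′ ⊨ φ))
mainTheorem14 = 6 , λ where
  f N t _         base zero {{n≢0}} w ℬ _ w∉ℬ |ℬ|≡ → contradiction refl (≢-nonZero⁻¹ 0 {{n≢0}})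
  f N t (f≤N , _) base (suc n)   w ℬ _ w∉ℬ |ℬ|≡ →
    let l , is-l  = ceilLog 2 ≤-refl (suc n)
        k , is-k  = ceilLog t (IsBase⇒2≤ N base) N
        φ , q≤ , separates = separate N k l w ℬ w∉ℬ (subst (_≤ N) (sym |ℬ|≡) (f≤N (suc n)))
                               (proj₁ is-l) (IsBase⇒≤! k base (proj₁ is-k))
    in φ , natᵁ-bound ≤-refl (IsBase⇒2≤ N base) is-l is-k q≤ , separates
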